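{- For any undirected graph $G=(V,E)$ we have $h(G) \le VC + \Delta^2 - \Delta + 1$, where $VC$ is the size of a minimum vertex cover of $G$ and $\Delta$ is the maximum degree of $G$.
   Context: All graphs are finite, simple and undirected. A harmonious coloring of a graph $G$ with $k$ colors is a proper vertex coloring $c : V(G) \to \{1,\dots,k\}$ such that for every two distinct colors $i,j$ there is at most one pair of adjacent vertices colored with $i$ and $j$. The harmonious chromatic number $h(G)$ is the minimum positive integer $k$ for which $G$ has a harmonious coloring with $k$ colors. A vertex cover of $G$ is a subset $V' \subseteq V$ such that every edge of $G$ has at least one endpoint in $V'$. -}

module Defs where

open import Data.Fin using (Fin; inject₁; funToFin; finToFun)
open import Data.Fin.Properties using (all?; any?; inject₁-injective; finToFun-funToFin)
  renaming (_≟_ to _≟ᶠ_)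
open import Data.Fin.Subset using (Subset; _∈_; ∣_∣; ⊤)
open import Data.Fin.Subset.Properties using (_∈?_; ∈⊤; anySubset?)
open import Data.List using (map; allFin)
open import Data.List.Extrema.Nat using (max)
open import Data.Nat using (ℕ; zero; suc; _≤_; _≤?_; z≤n; s≤s)
open import Data.Nat.Properties using () renaming (_≟_ to _≟ⁿ_)
open import Data.Product using (_×_; _,_; ∃; proj₁; proj₂)
open import Data.Sum using (_⊎_; inj₁)
open import Data.Vec using (tabulate)
open import Function using (_∘_)
open import Level using (0ℓ)
open import Relation.Binary.Core using (Rel)
open import Relation.Binary.Definitions using (Symmetric; Irreflexive; Decidable)
open import Relation.Binary.PropositionalEquality
  using (_≡_; _≢_; _≗_; refl; sym; trans)
open import Relation.Nullary using (Dec; yes; no; does; contradiction)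
open import Relation.Nullary.Decidable
  using (map′; ¬?; _×-dec_; _⊎-dec_; _→-dec_)
import Relation.Unary as U

record Graph : Set₁ where
  infix 4 _~_ _~?_
  field
    order    : ℕ
  Vertex : Set
  Vertex = Fin order
  field
    _~_      : Rel Vertex 0ℓ
    ~-sym    : Symmetric _~_
    ~-irrefl : Irreflexive _≡_ _~_
    _~?_     : Decidable _~_

IsLeast : (ℕ → Set) → ℕ → Set
IsLeast P k = P k × (∀ j → P j → k ≤ j)

least : {P : ℕ → Set} → U.Decidable P → ∀ k → P k → ∃ (IsLeast P)
least P? k pk with P? 0
... | yes p₀ = 0 , p₀ , λ _ _ → z≤n
least P? zero    pk | no ¬p₀ = contradiction pk ¬p₀
least P? (suc k) pk | no ¬p₀ with least (P? ∘ suc) k pk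
... | m , pm , m≤ = suc m , pm , λ where
  zero    p₀ → contradiction p₀ ¬p₀
  (suc j) pj → s≤s (m≤ j pj)

module _ (G : Graph) where
  open Graph G

  neighbours : Vertex → Subset order
  neighbours v = tabulate λ w → does (v ~? w)

  degree : Vertex → ℕ
  degree v = ∣ neighbours v ∣

  -- The default 0 only matters for the graph without vertices.
  maxDegree : ℕ
  maxDegree = max 0 (map degree (allFin order))

  IsVertexCover : Subset order → Set
  IsVertexCover S = ∀ u v → u ~ v → u ∈ S ⊎ v ∈ S

  HasVertexCover : ℕ → Set
  HasVertexCover k = ∃ λ S → IsVertexCover S × ∣ S ∣ ≡ k

  IsProper : ∀ {k} → (Vertex → Fin k) → Set
  IsProper c = ∀ u v → u ~ v → c u ≢ c v

  -- An adjacent pair coloured with i and j is listed with its i-coloured end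
  -- first; as i ≢ j, this picks exactly one orientation of each such edge.
  AtMostOneEdge : ∀ {k} → (Vertex → Fin k) → Fin k → Fin k → Set
  AtMostOneEdge c i j = ∀ u v u′ v′ →
    u  ~ v  → c u  ≡ i → c v  ≡ j →
    u′ ~ v′ → c u′ ≡ i → c v′ ≡ j →
    u ≡ u′ × v ≡ v′

  IsHarmonious : ∀ {k} → (Vertex → Fin k) → Set
  IsHarmonious c = IsProper c × (∀ i j → i ≢ j → AtMostOneEdge c i j)

  HarmoniouslyColourable : ℕ → Set
  HarmoniouslyColourable k = ∃ λ (c : Vertex → Fin k) → IsHarmonious c

  hasVertexCover? : U.Decidable HasVertexCover
  hasVertexCover? k = anySubset? λ S →
    (all? λ u → all? λ v → u ~? v →-dec (u ∈? S ⊎-dec v ∈? S))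
    ×-dec (∣ S ∣ ≟ⁿ k)

  minVertexCover : ∃ (IsLeast HasVertexCover)
  minVertexCover =
    least hasVertexCover? ∣ ⊤ {order} ∣ (⊤ , (λ _ _ _ → inj₁ ∈⊤) , refl)

  vertexCoverNumber : ℕ
  vertexCoverNumber = proj₁ minVertexCover

  isHarmonious? : ∀ {k} (c : Vertex → Fin k) → Dec (IsHarmonious c)
  isHarmonious? c =
    (all? λ u → all? λ v → u ~? v →-dec ¬? (c u ≟ᶠ c v))
    ×-dec
    (all? λ i → all? λ j → ¬? (i ≟ᶠ j) →-dec
      (all? λ u → all? λ v → all? λ u′ → all? λ v′ →
        u  ~? v  →-dec (c u  ≟ᶠ i →-dec (c v  ≟ᶠ j →-dec
        (u′ ~? v′ →-dec (c u′ ≟ᶠ i →-dec (c v′ ≟ᶠ j →-dec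
        (u ≟ᶠ u′ ×-dec v ≟ᶠ v′))))))))

  isHarmonious-resp-≗ : ∀ {k} {c d : Vertex → Fin k} →
                        c ≗ d → IsHarmonious c → IsHarmonious d
  isHarmonious-resp-≗ c≗d (proper , harm) =
    (λ u v e du≡dv →
      proper u v e (trans (c≗d u) (trans du≡dv (sym (c≗d v))))) ,
    (λ i j i≢j u v u′ v′ e p q e′ p′ q′ →
      harm i j i≢j u v u′ v′
        e  (trans (c≗d u)  p)  (trans (c≗d v)  q)
        e′ (trans (c≗d u′) p′) (trans (c≗d v′) q′))

  harmoniouslyColourable? : U.Decidable HarmoniouslyColourable
  harmoniouslyColourable? k = map′
    (λ (i , h) → finToFun i , h)
    (λ (c , h) → funToFin c ,
      isHarmonious-resp-≗ (λ v → sym (finToFun-funToFin c v)) h)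
    (any? λ i → isHarmonious? (finToFun {k} {order} i))

  inject₁-harmonious : IsHarmonious inject₁
  inject₁-harmonious =
    (λ u v e p → ~-irrefl (inject₁-injective p) e) ,
    (λ i j _ u v u′ v′ _ p q _ p′ q′ →
      inject₁-injective (trans p (sym p′)) ,
      inject₁-injective (trans q (sym q′)))

  minHarmonious : ∃ (IsLeast λ k → 1 ≤ k × HarmoniouslyColourable k)
  minHarmonious =
    least (λ k → (1 ≤? k) ×-dec harmoniouslyColourable? k)
          (suc order) (s≤s z≤n , inject₁ , inject₁-harmonious)

  harmoniousChromaticNumber : ℕ
  harmoniousChromaticNumber = proj₁ minHarmonious

{-# OPTIONS --safe #-}
-- Give the vertices of a minimum vertex cover S pairwise distinct private
-- colours, and colour the rest greedily with Δ² − Δ + 1 further colours so that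
-- distinct vertices with a common neighbour differ; a vertex has at most
-- Δ (Δ − 1) such rivals.  Every edge has an end in S, whose colour determines
-- it, and the colour of the other end then singles it out among the neighbours.
module Submission where

open import Defs
open import Data.Fin using (Fin; zero; suc; join; splitAt)
open import Data.Fin.Properties using (injective⇒≤; splitAt-join; ¬∀⟶∃¬)
  renaming (_≟_ to _≟ᶠ_)
open import Data.Fin.Subset using (Subset; inside; outside; _∈_; _-_; ∣_∣)
open import Data.Fin.Subset.Properties
  using (_∈?_; x∈p∧x≢y⇒x∈p-y; x∈p⇒∣p-x∣<∣p∣)
open import Data.List using (List; []; _∷_; length; map; concatMap; allFin)
open import Data.List.Extrema.Nat using (xs≤max)
open import Data.List.Membership.Propositional using (lose)
  renaming (_∈_ to _∈ˡ_; _∉_ to _∉ˡ_)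
open import Data.List.Membership.Propositional.Properties
  using (∈-map⁺; ∈-allFin; ∈-concatMap⁺)
open import Data.List.Membership.Setoid.Properties using (index-injective)
import Data.List.Membership.DecPropositional as DecMembership
open import Data.List.Properties using (length-map; length-++)
open import Data.List.Relation.Unary.All as All using (All; []; _∷_)
open import Data.List.Relation.Unary.All.Properties using (map⁺)
open import Data.List.Relation.Unary.Any using (here; there; index)
open import Data.Nat using (ℕ; suc; pred; _≤_; _<_; _+_; _*_; _∸_; _^_; z≤n; s≤s)
open import Data.Nat.Properties
  using (≤-trans; <-≤-trans; <-irrefl; m≤n+m; +-mono-≤; *-monoˡ-≤;
         pred-mono-≤; *-distribˡ-∸; *-identityʳ; +-assoc; +-comm)
open import Data.Product using (_×_; _,_; ∃; proj₁; proj₂; swap)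
open import Data.Sum using (_⊎_; inj₁; inj₂)
open import Data.Sum.Properties using (inj₁-injective; inj₂-injective)
open import Data.Vec using ([]; _∷_; here; there)
open import Data.Vec.Functional using (updateAt)
open import Data.Vec.Functional.Properties using (updateAt-updates; updateAt-minimal)
open import Data.Vec.Properties using (lookup∘tabulate; lookup⇒[]=; []=⇒lookup)
open import Function using (_∘_; const)
open import Level using (0ℓ)
open import Relation.Binary.Core using (Rel)
open import Relation.Binary.Definitions using (Symmetric; Irreflexive)
open import Relation.Binary.PropositionalEquality
open import Relation.Nullary using (yes; no; contradiction)
open import Relation.Nullary.Decidable using (dec-true)

-- Listing subsets and counting.

private variable
  n k : ℕ

-- Positions in this list later serve as the private colours of the cover, and list lengths bound
-- the number of rivals.
elements : Subset n → List (Fin n)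
elements []            = []
elements (inside ∷ p)  = zero ∷ map suc (elements p)
elements (outside ∷ p) = map suc (elements p)

length-elements : (p : Subset n) → length (elements p) ≡ ∣ p ∣
length-elements []            = refl
length-elements (inside ∷ p)  =
  cong suc (trans (length-map suc (elements p)) (length-elements p))
length-elements (outside ∷ p) =
  trans (length-map suc (elements p)) (length-elements p)

∈-elements : {p : Subset n} {x : Fin n} → x ∈ p → x ∈ˡ elements p
∈-elements                    here        = here refl
∈-elements {p = inside ∷ _}  (there x∈p) = there (∈-map⁺ suc (∈-elements x∈p))
∈-elements {p = outside ∷ _} (there x∈p) = ∈-map⁺ suc (∈-elements x∈p)

elements-⊆ : (p : Subset n) → All (_∈ p) (elements p)
elements-⊆ []            = []
elements-⊆ (inside ∷ p)  = here ∷ map⁺ (All.map there (elements-⊆ p))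
elements-⊆ (outside ∷ p) = map⁺ (All.map there (elements-⊆ p))

length-concatMap-≤ : ∀ {A B : Set} (f : A → List B) {xs : List A} →
                     All (λ x → length (f x) ≤ k) xs →
                     length (concatMap f xs) ≤ length xs * k
length-concatMap-≤ f []                    = z≤n
length-concatMap-≤ f {x ∷ xs} (fx≤k ∷ fxs≤k)
  rewrite length-++ (f x) {concatMap f xs} =
  +-mono-≤ fx≤k (length-concatMap-≤ f fxs≤k)

-- If every colour occurred in `xs`, sending each one to its position would inject `Fin k` into
-- fewer than `k` positions. Decidable membership turns this refutation into a witness.
∃-fresh : (xs : List (Fin k)) → length xs < k → ∃ λ c → c ∉ˡ xs
∃-fresh {k} xs ∣xs∣<k = ¬∀⟶∃¬ k (_∈ˡ xs) (_∈ˡ? xs) λ all∈ →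
  <-irrefl refl (<-≤-trans ∣xs∣<k
    (injective⇒≤ (index-injective (setoid (Fin k)) (all∈ _) (all∈ _))))
  where open DecMembership (_≟ᶠ_ {k}) renaming (_∈?_ to _∈ˡ?_)

-- Greedy colouring of a relation of bounded degree.

module Greedy {n k : ℕ} {_#_ : Rel (Fin n) 0ℓ}
              (#-sym : Symmetric _#_) (#-irrefl : Irreflexive _≡_ _#_)
              (rivals : Fin n → List (Fin n))
              (#⇒∈rivals : ∀ {v w} → v # w → w ∈ˡ rivals v)
              (∣rivals∣≤k : ∀ v → length (rivals v) ≤ k) where

  -- `f` is total to avoid partial colourings: vertices outside `vs` carry provisional colours.
  ProperOn : List (Fin n) → (Fin n → Fin (suc k)) → Set
  ProperOn vs f = ∀ {v w} → v ∈ˡ vs → w ∈ˡ vs → v # w → f v ≢ f w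

  extend : ∀ x {vs} → ∃ (ProperOn vs) → ∃ (ProperOn (x ∷ vs))
  extend x {vs} (f , proper) = f′ , proper′
    where
    -- At most `k` of the `suc k` colours occur on rivals. Provisional colours of untreated rivals
    -- are avoided as well, at no cost to the bound.
    fresh : ∃ λ c → c ∉ˡ map f (rivals x)
    fresh = ∃-fresh (map f (rivals x))
      (s≤s (subst (_≤ k) (sym (length-map f (rivals x))) (∣rivals∣≤k x)))

    f′ : Fin n → Fin (suc k)
    f′ = updateAt f x (const (proj₁ fresh))

    f′-old : ∀ {v} → v ≢ x → f′ v ≡ f v
    f′-old {v} = updateAt-minimal v x f

    -- By irreflexivity `w` differs from `x`, so it keeps its old colour, which is among those
    -- avoided.
    f′-new : ∀ {w} → x # w → f′ x ≢ f′ w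
    f′-new x#w f′x≡f′w = proj₂ fresh
      (subst (_∈ˡ map f (rivals x))
        (trans (sym (f′-old (λ w≡x → #-irrefl (sym w≡x) x#w)))
               (trans (sym f′x≡f′w) (updateAt-updates x f)))
        (∈-map⁺ f (#⇒∈rivals x#w)))

    old∈ : ∀ {v} → v ≢ x → v ∈ˡ x ∷ vs → v ∈ˡ vs
    old∈ v≢x (here v≡x)   = contradiction v≡x v≢x
    old∈ v≢x (there v∈vs) = v∈vs

    proper′ : ProperOn (x ∷ vs) f′
    proper′ {v} {w} v∈ w∈ v#w eq with v ≟ᶠ x | w ≟ᶠ x
    ... | yes refl | _        = f′-new v#w eq
    ... | no _     | yes refl = f′-new (#-sym v#w) (sym eq)
    ... | no v≢x   | no w≢x   = proper (old∈ v≢x v∈) (old∈ w≢x w∈) v#w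
      (trans (sym (f′-old v≢x)) (trans eq (f′-old w≢x)))

  properOn : ∀ vs → ∃ (ProperOn vs)
  properOn []       = const zero , λ ()
  properOn (v ∷ vs) = extend v (properOn vs)

  colouring : ∃ λ (f : Fin n → Fin (suc k)) → ∀ {v w} → v # w → f v ≢ f w
  colouring with properOn (allFin n)
  ... | f , proper = f , proper (∈-allFin _) (∈-allFin _)

-- Separating vertices with a common neighbour.

module _ (G : Graph) where
  open Graph G

  private
    Δ : ℕ
    Δ = maxDegree G

  degree≤maxDegree : ∀ v → degree G v ≤ Δ
  degree≤maxDegree v =
    All.lookup (xs≤max 0 (map (degree G) (allFin order)))
               (∈-map⁺ (degree G) (∈-allFin v))

  ~⇒∈neighbours : ∀ {v w} → v ~ w → w ∈ neighbours G v
  ~⇒∈neighbours {v} {w} v~w = lookup⇒[]= w _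
    (trans (lookup∘tabulate _ w) (dec-true (v ~? w) v~w))

  ∈neighbours⇒~ : ∀ {v w} → w ∈ neighbours G v → v ~ w
  ∈neighbours⇒~ {v} {w} w∈ with v ~? w | trans (sym (lookup∘tabulate _ w)) ([]=⇒lookup w∈)
  ... | yes v~w | _  = v~w
  ... | no  _   | ()

  CommonNeighbour : Rel Vertex 0ℓ
  CommonNeighbour v w = v ≢ w × ∃ λ s → v ~ s × s ~ w

  -- These are the ends of walks of length two from `v`. Excluding the return to `v` improves the
  -- bound from Δ² to Δ (Δ - 1); repeated entries only make the list longer.
  rivals : Vertex → List Vertex
  rivals v = concatMap (λ s → elements (neighbours G s - v)) (elements (neighbours G v))

  commonNeighbour⇒∈rivals : ∀ {v w} → CommonNeighbour v w → w ∈ˡ rivals v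
  commonNeighbour⇒∈rivals (v≢w , s , v~s , s~w) =
    ∈-concatMap⁺ _ (lose (∈-elements (~⇒∈neighbours v~s))
      (∈-elements (x∈p∧x≢y⇒x∈p-y (~⇒∈neighbours s~w) (v≢w ∘ sym))))

  ∣rivals∣≤ : ∀ v → length (rivals v) ≤ Δ * pred Δ
  ∣rivals∣≤ v = ≤-trans
    (length-concatMap-≤ _ (All.map bound (elements-⊆ (neighbours G v))))
    (*-monoˡ-≤ (pred Δ)
      (subst (_≤ Δ) (sym (length-elements (neighbours G v))) (degree≤maxDegree v)))
    where
    bound : ∀ {s} → s ∈ neighbours G v → length (elements (neighbours G s - v)) ≤ pred Δ
    bound {s} s∈ = subst (_≤ pred Δ) (sym (length-elements (neighbours G s - v)))
      -- `v` is itself a neighbour of `s`, so its removal leaves strictly fewer than `degree G s`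
      -- vertices.
      (pred-mono-≤ (<-≤-trans
        (x∈p⇒∣p-x∣<∣p∣ (~⇒∈neighbours (~-sym (∈neighbours⇒~ s∈))))
        (degree≤maxDegree s)))

  commonNeighbour-colouring : ∃ λ (f : Vertex → Fin (suc (Δ * pred Δ))) →
                              ∀ {v w} → CommonNeighbour v w → f v ≢ f w
  commonNeighbour-colouring = Greedy.colouring
    (λ (v≢w , s , v~s , s~w) → v≢w ∘ sym , s , ~-sym s~w , ~-sym v~s)
    (λ v≡w (v≢w , _) → v≢w v≡w)
    rivals commonNeighbour⇒∈rivals ∣rivals∣≤

  -- The harmonious colouring built from a vertex cover.

  module _ {S : Subset order} (cover : IsVertexCover G S) where

    private
      a b : ℕ
      a = length (elements S)
      b = suc (Δ * pred Δ)

      f : Vertex → Fin b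
      f = proj₁ commonNeighbour-colouring

    label : Vertex → Fin a ⊎ Fin b
    label v with v ∈? S
    ... | yes v∈S = inj₁ (index (∈-elements v∈S))
    ... | no  _   = inj₂ (f v)

    label-injective-or-f : ∀ u v → label u ≡ label v → u ≡ v ⊎ f u ≡ f v
    label-injective-or-f u v eq with u ∈? S | v ∈? S
    ... | yes u∈S | yes v∈S = inj₁ (index-injective (setoid Vertex)
                                (∈-elements u∈S) (∈-elements v∈S) (inj₁-injective eq))
    ... | no  _   | no  _   = inj₂ (inj₂-injective eq)

    -- Membership is required of `u` only: a label in the left summand forces `v` into `S` too, and
    -- positions in `elements S` identify vertices.
    label-injective-on-cover : ∀ u v → u ∈ S → label u ≡ label v → u ≡ v
    label-injective-on-cover u v u∈S eq with u ∈? S | v ∈? S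
    ... | yes u∈S | yes v∈S = index-injective (setoid Vertex)
                                (∈-elements u∈S) (∈-elements v∈S) (inj₁-injective eq)
    ... | no  u∉S | _       = contradiction u∈S u∉S

    -- If `v` and `w` were distinct, `s` would be their common neighbour and `f` would separate
    -- them.
    label-injective-on-neighbours : ∀ {s v w} → s ~ v → s ~ w → label v ≡ label w → v ≡ w
    label-injective-on-neighbours {s} {v} {w} s~v s~w eq
      with v ≟ᶠ w | label-injective-or-f v w eq
    ... | yes v≡w | _          = v≡w
    ... | no  _   | inj₁ v≡w   = v≡w
    ... | no  v≢w | inj₂ fv≡fw = contradiction fv≡fw
      (proj₂ commonNeighbour-colouring (v≢w , s , ~-sym s~v , s~w))

    colour : Vertex → Fin (a + b)
    colour = join a b ∘ label

    colour⇒label : ∀ {u v} → colour u ≡ colour v → label u ≡ label v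
    colour⇒label {u} {v} eq = trans (sym (splitAt-join a b (label u)))
      (trans (cong (splitAt a) eq) (splitAt-join a b (label v)))

    colour-proper : IsProper G colour
    colour-proper u v u~v eq with cover u v u~v
    ... | inj₁ u∈S = ~-irrefl (label-injective-on-cover u v u∈S (colour⇒label eq)) u~v
    ... | inj₂ v∈S = ~-irrefl (label-injective-on-cover v u v∈S (colour⇒label (sym eq)))
                              (~-sym u~v)

    -- The covered end is recovered first; then `v` and `v′` are equally labelled neighbours of one
    -- vertex.
    edge-determined : ∀ {u v u′ v′} → u ∈ S → u ~ v → u′ ~ v′ →
                      label u ≡ label u′ → label v ≡ label v′ → u ≡ u′ × v ≡ v′
    edge-determined u∈S u~v u′~v′ eqᵘ eqᵛ with label-injective-on-cover _ _ u∈S eqᵘ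
    ... | refl = refl , label-injective-on-neighbours u~v u′~v′ eqᵛ

    colour-harmonious : IsHarmonious G colour
    colour-harmonious = colour-proper , λ i j _ u v u′ v′ u~v cu cv u′~v′ cu′ cv′ →
      let eqᵘ = colour⇒label (trans cu (sym cu′))
          eqᵛ = colour⇒label (trans cv (sym cv′))
      in case-cover u~v u′~v′ eqᵘ eqᵛ
      where
      case-cover : ∀ {u v u′ v′} → u ~ v → u′ ~ v′ →
                   label u ≡ label u′ → label v ≡ label v′ → u ≡ u′ × v ≡ v′
      case-cover {u} {v} u~v u′~v′ eqᵘ eqᵛ with cover u v u~v
      ... | inj₁ u∈S = edge-determined u∈S u~v u′~v′ eqᵘ eqᵛ
      -- Both edges are reversed so that the covered end comes first.
      ... | inj₂ v∈S = swap (edge-determined v∈S (~-sym u~v) (~-sym u′~v′) eqᵛ eqᵘ)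

    harmonious-bound : harmoniousChromaticNumber G ≤ a + b
    harmonious-bound = proj₂ (proj₂ (minHarmonious G)) (a + b)
      -- The number of colours is positive because `b` is a successor.
      (≤-trans (s≤s z≤n) (m≤n+m b a) , colour , colour-harmonious)

-- Arithmetic and the final bound.

m*pred[m]≡m²∸m : ∀ m → m * pred m ≡ m ^ 2 ∸ m
m*pred[m]≡m²∸m m = begin
  m * pred m        ≡⟨ *-distribˡ-∸ m m 1 ⟩
  -- `m ^ 2` unfolds to `m * (m * 1)`, so a factor 1 is inserted on the left and removed on the
  -- right.
  m * m ∸ m * 1     ≡⟨ cong₂ (λ x y → m * x ∸ y) (sym (*-identityʳ m)) (*-identityʳ m) ⟩
  m ^ 2 ∸ m         ∎
  where open ≡-Reasoning

theorem14 : (G : Graph) →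
    harmoniousChromaticNumber G ≤ vertexCoverNumber G + (maxDegree G ^ 2 ∸ maxDegree G) + 1
theorem14 G with proj₁ (proj₂ (minVertexCover G))
... | S , cover , ∣S∣≡vc = subst (harmoniousChromaticNumber G ≤_) colours≡
                                 (harmonious-bound G cover)
  where
  open ≡-Reasoning
  Δ = maxDegree G
  colours≡ : length (elements S) + suc (Δ * pred Δ) ≡ vertexCoverNumber G + (Δ ^ 2 ∸ Δ) + 1
  colours≡ = begin
    length (elements S) + suc (Δ * pred Δ)
      ≡⟨ cong₂ (λ x y → x + suc y) (trans (length-elements S) ∣S∣≡vc) (m*pred[m]≡m²∸m Δ) ⟩
    vertexCoverNumber G + suc (Δ ^ 2 ∸ Δ)
      ≡⟨ cong (vertexCoverNumber G +_) (+-comm 1 (Δ ^ 2 ∸ Δ)) ⟩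
    vertexCoverNumber G + (Δ ^ 2 ∸ Δ + 1)
      ≡⟨ +-assoc (vertexCoverNumber G) (Δ ^ 2 ∸ Δ) 1 ⟨
    vertexCoverNumber G + (Δ ^ 2 ∸ Δ) + 1 ∎
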